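{- The map $u \longmapsto (\mathsf{P}(u), \mathsf{Q}(u))$ is a bijection between the elements of $A^*$ and the set formed by the pairs $\left((T_L, T_R), (S_L, S_R)\right)$ where (i) $(T_L, T_R)$ is a pair of twin binary search trees: $T_L$ (resp. $T_R$) is a left (resp. right) binary search tree, and $T_L$ and $T_R$ have the same inorder reading; (ii) $(S_L, S_R)$ is a pair of twin binary trees where $S_L$ (resp. $S_R$) is an increasing (resp. decreasing) binary tree, and $S_L$ and $S_R$ have the same inorder reading; (iii) $(T_L, T_R)$ and $(S_L, S_R)$ have the same shape.
   Context: $A = \{a_1 < a_2 < \cdots\}$ is a totally ordered infinite alphabet and $A^*$ is the free monoid of words on $A$. The standardized word $\mathrm{std}(u)$ of $u\in A^*$ is the unique permutation of size $|u|$ having the same inversions as $u$ (pairs $(i,j)$ with $i<j$ and $u_i>u_j$). A binary tree is either a leaf (empty tree) or a node with a left and a right binary subtree. The inorder traversal visits recursively the left subtree, then the root, then the right subtree; the inorder reading of a labeled tree is the word of the labels of its nodes in this order. The shape of a labeled tree (or pair of trees) is obtained by forgetting labels. The canopy of a binary tree with $n$ nodes is the word of length $n-1$ on $\{0,1\}$ obtained by reading its leaves from left to right except the first and the last one, writing $0$ if the leaf is a right child and $1$ if it is a left child. A pair of twin binary trees is a pair $(T_L,T_R)$ of binary trees with the same number $n$ of nodes whose canopies differ at every position $1 \leq i \leq n-1$; a labeled pair is called a pair of twin binary trees if its shape is. A tree with nodes labeled by $A$ is a right (resp. left) binary search tree if for every node $x$ labeled by $b$, every label $a$ in its left subtree and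 every label $c$ in its right subtree, $a \leq b < c$ (resp. $a < b \leq c$). A pair of twin binary search trees is an $A$-labeled pair of twin binary trees $(T_L,T_R)$ such that $T_L$ is a left binary search tree, $T_R$ is a right binary search tree, and both have the same inorder reading. An increasing (resp. decreasing) binary tree is a binary tree with $n$ nodes bijectively labeled on $\{1,\dots,n\}$ such that the label of each child is greater (resp. smaller) than the label of its parent. Leaf insertion of a letter $a$ into a right (resp. left) binary search tree $T$: if $T$ is empty, return the one-node tree labeled $a$; otherwise, with $b$ the label of the root, if $a \leq b$ (resp. $a<b$) recursively leaf insert $a$ into the left subtree, otherwise into the right subtree. The Baxter $\mathsf{P}$-symbol of $u$ is $\mathsf{P}(u) = (T_L,T_R)$ where $T_L$ (resp. $T_R$) is the left (resp. right) binary search tree obtained by leaf inserting the letters of $u$ from left to right (resp. right to left), starting from the empty tree. For a word $u$, $\mathrm{incr}(u)$ is the empty tree if $u$ is empty, and otherwise is the tree with root labeled $a$, left subtree $\mathrm{incr}(v)$ and right subtree $\mathrm{incr}(w)$, where $u = v a w$, $a = \min(u)$ and $a < \min(v)$ (leftmost minimal letter). Likewise $\mathrm{decr}(u)$ is empty if $u$ is empty, and otherwise has root labeled $b$, left subtree $\mathrm{decr}(v)$ and right subtree $\mathrm{decr}(w)$, where $u = v b w$, $b = \max(u)$ and $b > \max(w)$ (rightmost maximal letter). The Baxter $\mathsf{Q}$-symbol of $u$ is $\mathsf{Q}(u) = (S_L,S_R)$ with $S_L = \mathrm{incr}(\mathrm{std}(u)^{ -1})$ and $S_R = \mathrm{decr}(\mathrm{std}(u)^{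 -1})$. -}

module Defs where

open import Data.Nat.Base using (ℕ; zero; suc; _∸_; _≤_; _<_; z≤n; s≤s)
open import Data.Nat.Properties
  using (_<?_; _≤?_; ≤-refl; ≤-trans; <-trans; <-≤-trans; ≤-<-trans; ≤-reflexive; ≤-antisym; <-cmp; <-asym; <⇒≤; ≤⇒≯; <⇒≱;
         ≮⇒≥; n≤1+n; m≤n⇒m≤1+n; <-≤-connex; ≤-<-connex)
open import Data.Nat.Induction using (<-wellFounded)
open import Induction.WellFounded using (Acc; acc)
open import Data.Fin.Base as Fin using (Fin; zero; suc; toℕ; fromℕ<; punchIn)
open import Data.Fin.Patterns using (0F; 1F)
import Data.Fin.Properties as Fin
open import Data.Fin.Permutation
  using (Permutation′; _⟨$⟩ʳ_; _⟨$⟩ˡ_; insert; flip; id; inverseˡ; inverseʳ; _≈_)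
open import Data.List.Base as List
  using (List; []; _∷_; [_]; _++_; length; lookup; filter; take; drop; tabulate; upTo)
open import Data.List.Properties
  using (length-filter; filter-accept; filter-reject; ∷-injective)
open import Data.List.Relation.Unary.All as All using (All; []; _∷_)
import Data.List.Relation.Unary.All.Properties as All
open import Data.List.Relation.Binary.Pointwise using (Pointwise)
open import Data.List.Relation.Binary.Permutation.Propositional using (_↭_)
import Data.Tree.Binary as Binary
open Binary using (leaf; node; #nodes)
import Data.Tree.Binary.Relation.Unary.All as Tree
open import Data.Product.Base using (Σ; _×_; _,_; proj₁; proj₂)
open import Data.Sum.Base using (inj₁; inj₂)
open import Data.Unit.Base using (⊤; tt)
open import Data.Empty using (⊥-elim)
open import Function.Bundles using (_⇔_; mk⇔; Equivalence)
open import Relation.Nullary using (¬_; yes; no)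
open import Relation.Binary.Definitions using (tri<; tri≈; tri>)
open import Relation.Binary.PropositionalEquality
  using (_≡_; _≢_; refl; sym; trans; cong; subst; subst₂)

-- The alphabet a₁ < a₂ < ⋯ is ℕ with its usual order, aᵢ being i ∸ 1.
Letter : Set
Letter = ℕ

Word : Set
Word = List Letter

Tree : Set → Set
Tree A = Binary.Tree A ⊤

TreePair : Set → Set
TreePair A = Tree A × Tree A

inorder : ∀ {A} → Tree A → List A
inorder = Binary.Infix.toList

shape : ∀ {A} → Tree A → Tree ⊤
shape = Binary.mapₙ (λ _ → tt)

-- The argument s is the side on which the whole tree hangs; it shows up in the
-- result only when that tree is a single leaf.
leafSides : ∀ {A} → Fin 2 → Tree A → List (Fin 2)
leafSides s (leaf _)     = [ s ]
leafSides s (node l _ r) = leafSides 1F l ++ leafSides 0F r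

-- A tree with n ≥ 1 nodes has n + 1 leaves, so that n ∸ 1 of them remain. The
-- canopy of the empty tree is the empty word.
canopy : ∀ {A} → Tree A → List (Fin 2)
canopy t = take (#nodes t ∸ 1) (drop 1 (leafSides 0F t))

record IsTwinShape (p : TreePair ⊤) : Set where
  field
    same-size         : #nodes (proj₁ p) ≡ #nodes (proj₂ p)
    canopies-opposite : Pointwise _≢_ (canopy (proj₁ p)) (canopy (proj₂ p))

pairShape : ∀ {A} → TreePair A → TreePair ⊤
pairShape (l , r) = shape l , shape r

IsTwin : ∀ {A} → TreePair A → Set
IsTwin p = IsTwinShape (pairShape p)

AllLabels : ∀ {A} → (A → Set) → Tree A → Set
AllLabels P t = Tree.All P (λ _ → ⊤) t

data IsLeftBST : Tree Letter → Set where
  leaf : IsLeftBST (leaf tt)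
  node : ∀ {l b r} → AllLabels (_< b) l → AllLabels (b ≤_) r →
         IsLeftBST l → IsLeftBST r → IsLeftBST (node l b r)

data IsRightBST : Tree Letter → Set where
  leaf : IsRightBST (leaf tt)
  node : ∀ {l b r} → AllLabels (_≤ b) l → AllLabels (b <_) r →
         IsRightBST l → IsRightBST r → IsRightBST (node l b r)

data RootSatisfies {A : Set} (P : A → Set) : Tree A → Set where
  leaf : RootSatisfies P (leaf tt)
  node : ∀ {l a r} → P a → RootSatisfies P (node l a r)

data ParentChild {A : Set} (R : A → A → Set) : Tree A → Set where
  leaf : ParentChild R (leaf tt)
  node : ∀ {l a r} → RootSatisfies (R a) l → RootSatisfies (R a) r →
         ParentChild R l → ParentChild R r → ParentChild R (node l a r)

-- Bijectivity of the labeling of the n nodes by 1, …, n: the labels form a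
-- permutation of the list 1, …, n.
IsStandardLabeled : Tree ℕ → Set
IsStandardLabeled t = inorder t ↭ List.map suc (upTo (#nodes t))

IsIncreasing IsDecreasing : Tree ℕ → Set
IsIncreasing t = IsStandardLabeled t × ParentChild (λ parent child → parent < child) t
IsDecreasing t = IsStandardLabeled t × ParentChild (λ parent child → child < parent) t

SameInversions : (u : Word) → Permutation′ (length u) → Set
SameInversions u σ = ∀ i j → i Fin.< j →
  (lookup u j < lookup u i ⇔ (σ ⟨$⟩ʳ j) Fin.< (σ ⟨$⟩ʳ i))

below : Letter → Word → ℕ
below a u = length (filter (_<? a) u)

private
  below≤length : ∀ a u → below a u < suc (length u)
  below≤length a u = s≤s (length-filter (_<? a) u)

-- The permutation with the same inversions as u: the first letter a is sent to
-- the rank below a u, and the remaining values are those of std u, shifted so as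
-- to avoid it. See std-sameInversions and std-unique.
std : (u : Word) → Permutation′ (length u)
std []      = id
std (a ∷ u) = insert zero (fromℕ< (below≤length a u)) (std u)

private
  punchIn-< : ∀ {n} (k : Fin (suc n)) (j : Fin n) → toℕ j < toℕ k → toℕ (punchIn k j) ≡ toℕ j
  punchIn-< (suc k) zero    _       = refl
  punchIn-< (suc k) (suc j) (s≤s p) = cong suc (punchIn-< k j p)

  punchIn-≥ : ∀ {n} (k : Fin (suc n)) (j : Fin n) → toℕ k ≤ toℕ j → toℕ (punchIn k j) ≡ suc (toℕ j)
  punchIn-≥ zero    j       _       = refl
  punchIn-≥ (suc k) (suc j) (s≤s p) = cong suc (punchIn-≥ k j p)

  below-yes : ∀ {a b} u → b < a → below a (b ∷ u) ≡ suc (below a u)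
  below-yes {a} u b<a = cong length (filter-accept (_<? a) {xs = u} b<a)

  below-no : ∀ {a b} u → ¬ b < a → below a (b ∷ u) ≡ below a u
  below-no {a} u b≮a = cong length (filter-reject (_<? a) {xs = u} b≮a)

  below-mono : ∀ {a c} u → a ≤ c → below a u ≤ below c u
  below-mono []      a≤c = z≤n
  below-mono {a} {c} (b ∷ u) a≤c with b <? a | b <? c
  ... | yes b<a | yes b<c rewrite below-yes u b<a | below-yes u b<c = s≤s (below-mono u a≤c)
  ... | yes b<a | no b≮c  = ⊥-elim (b≮c (<-≤-trans b<a a≤c))
  ... | no b≮a  | yes b<c rewrite below-no u b≮a | below-yes u b<c = m≤n⇒m≤1+n (below-mono u a≤c)
  ... | no b≮a  | no b≮c  rewrite below-no u b≮a | below-no u b≮c = below-mono u a≤c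

  rank : ∀ u → Fin (length u) → ℕ
  rank u j = toℕ (std u ⟨$⟩ʳ j)

  std-zero : ∀ a u → rank (a ∷ u) zero ≡ below a u
  std-zero a u = Fin.toℕ-fromℕ< (below≤length a u)

  std-small : ∀ a u j → rank u j < below a u → rank (a ∷ u) (suc j) ≡ rank u j
  std-small a u@(_ ∷ _) j p = punchIn-< (fromℕ< (below≤length a u)) (std u ⟨$⟩ʳ j)
    (subst (rank u j <_) (sym (std-zero a u)) p)

  std-large : ∀ a u j → below a u ≤ rank u j → rank (a ∷ u) (suc j) ≡ suc (rank u j)
  std-large a u@(_ ∷ _) j p = punchIn-≥ (fromℕ< (below≤length a u)) (std u ⟨$⟩ʳ j)
    (subst (_≤ rank u j) (sym (std-zero a u)) p)

  rank-below : ∀ a u j → (rank u j < below a u → lookup u j < a) × (lookup u j < a → rank u j < below a u)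
  rank-below a (b ∷ u) zero with b <? a
  ... | yes b<a rewrite std-zero b u | below-yes u b<a =
    (λ _ → b<a) , (λ _ → s≤s (below-mono u (<⇒≤ b<a)))
  ... | no b≮a rewrite std-zero b u | below-no u b≮a =
    (λ p → ⊥-elim (<⇒≱ p (below-mono u (≮⇒≥ b≮a)))) , (λ q → ⊥-elim (b≮a q))
  rank-below a (b ∷ u) (suc j) with b <? a | rank u j <? below b u
  ... | yes b<a | yes r<b rewrite std-small b u j r<b | below-yes u b<a =
    (λ _ → <-trans (proj₁ (rank-below b u j) r<b) b<a) ,
    (λ q → m≤n⇒m≤1+n (proj₂ (rank-below a u j) q))
  ... | yes b<a | no r≮b rewrite std-large b u j (≮⇒≥ r≮b) | below-yes u b<a =
    (λ { (s≤s p) → proj₁ (rank-below a u j) p }) ,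
    (λ q → s≤s (proj₂ (rank-below a u j) q))
  ... | no b≮a | yes r<b rewrite std-small b u j r<b | below-no u b≮a = rank-below a u j
  ... | no b≮a | no r≮b rewrite std-large b u j (≮⇒≥ r≮b) | below-no u b≮a =
    (λ p → ⊥-elim (r≮b (<-≤-trans (≤-trans (n≤1+n _) p) (below-mono u (≮⇒≥ b≮a))))) ,
    (λ q → ⊥-elim (r≮b (proj₂ (rank-below b u j) (<-≤-trans q (≮⇒≥ b≮a)))))

std-sameInversions : ∀ u → SameInversions u (std u)
std-sameInversions (a ∷ u) zero (suc j) _ = mk⇔ to from
  where
  to : lookup u j < a → rank (a ∷ u) (suc j) < rank (a ∷ u) zero
  to q with r<a ← proj₂ (rank-below a u j) q
    rewrite std-small a u j r<a | std-zero a u = r<a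

  from : rank (a ∷ u) (suc j) < rank (a ∷ u) zero → lookup u j < a
  from p with rank u j <? below a u
  ... | yes r<a = proj₁ (rank-below a u j) r<a
  ... | no r≮a rewrite std-large a u j (≮⇒≥ r≮a) | std-zero a u =
    ⊥-elim (r≮a (≤-trans (n≤1+n _) p))
std-sameInversions (a ∷ u@(_ ∷ _)) (suc i) (suc j) (s≤s i<j) = mk⇔ to from
  where
  k = fromℕ< (below≤length a u)
  σi = std u ⟨$⟩ʳ i
  σj = std u ⟨$⟩ʳ j
  module IH = Equivalence (std-sameInversions u i j i<j)

  to : lookup u j < lookup u i → punchIn k σj Fin.< punchIn k σi
  to q with punchIn k σj Fin.<? punchIn k σi
  ... | yes p = p
  ... | no ¬p = ⊥-elim (<⇒≱ (IH.to q) (Fin.punchIn-cancel-≤ k σi σj (≮⇒≥ ¬p)))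

  from : punchIn k σj Fin.< punchIn k σi → lookup u j < lookup u i
  from p with σj Fin.<? σi
  ... | yes q = IH.from q
  ... | no ¬q = ⊥-elim (<⇒≱ p (Fin.punchIn-mono-≤ k σi σj (≮⇒≥ ¬q)))

private
  module _ {n} (f : Fin n → Fin n) (mono : ∀ i j → i Fin.< j → f i Fin.< f j) where

    expansive : ∀ m (i : Fin n) → toℕ i ≡ m → m ≤ toℕ (f i)
    expansive zero    i       eq = z≤n
    expansive (suc m) (suc i) refl = ≤-trans
      (s≤s (expansive m (Fin.inject₁ i) (Fin.toℕ-inject₁ i)))
      (mono (Fin.inject₁ i) (suc i) (s≤s (≤-reflexive (Fin.toℕ-inject₁ i))))

  ⟨$⟩ʳ-injective : ∀ {n} (π : Permutation′ n) {i j} → π ⟨$⟩ʳ i ≡ π ⟨$⟩ʳ j → i ≡ j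
  ⟨$⟩ʳ-injective π eq = trans (sym (inverseˡ π)) (trans (cong (π ⟨$⟩ˡ_) eq) (inverseˡ π))

  sameInversions⇒mono : ∀ u σ τ → SameInversions u σ → SameInversions u τ →
    ∀ i j → σ ⟨$⟩ʳ i Fin.< σ ⟨$⟩ʳ j → τ ⟨$⟩ʳ i Fin.< τ ⟨$⟩ʳ j
  sameInversions⇒mono u σ τ invσ invτ i j p with <-cmp (toℕ i) (toℕ j)
  ... | tri> _ _ j<i = Equivalence.to (invτ j i j<i) (Equivalence.from (invσ j i j<i) p)
  ... | tri≈ _ i≡j _ with refl ← Fin.toℕ-injective i≡j = ⊥-elim (<⇒≱ p ≤-refl)
  ... | tri< i<j i≢j _ with <-cmp (toℕ (τ ⟨$⟩ʳ i)) (toℕ (τ ⟨$⟩ʳ j))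
  ...   | tri< q _ _ = q
  ...   | tri≈ _ q _ = ⊥-elim (i≢j (cong toℕ (⟨$⟩ʳ-injective τ (Fin.toℕ-injective q))))
  ...   | tri> _ _ q = ⊥-elim (<-asym p (Equivalence.to (invσ i j i<j) (Equivalence.from (invτ i j i<j) q)))

  sameInversions⇒≤ : ∀ u σ τ → SameInversions u σ → SameInversions u τ →
    ∀ i → toℕ (σ ⟨$⟩ʳ i) ≤ toℕ (τ ⟨$⟩ʳ i)
  sameInversions⇒≤ u σ τ invσ invτ i =
    subst (λ k → toℕ (σ ⟨$⟩ʳ i) ≤ toℕ (τ ⟨$⟩ʳ k)) (inverseˡ σ)
      (expansive (λ k → τ ⟨$⟩ʳ (σ ⟨$⟩ˡ k))
        (λ k l k<l → sameInversions⇒mono u σ τ invσ invτ _ _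
          (subst₂ Fin._<_ (sym (inverseʳ σ)) (sym (inverseʳ σ)) k<l))
        _ (σ ⟨$⟩ʳ i) refl)

std-unique : ∀ u σ → SameInversions u σ → σ ≈ std u
std-unique u σ inv i = Fin.toℕ-injective (≤-antisym
  (sameInversions⇒≤ u σ (std u) inv (std-sameInversions u) i)
  (sameInversions⇒≤ u (std u) σ (std-sameInversions u) inv i))

-- The word σ(1) ⋯ σ(n), with values in 1, …, n.
permutationWord : ∀ {n} → Permutation′ n → List ℕ
permutationWord σ = tabulate (λ i → suc (toℕ (σ ⟨$⟩ʳ i)))

leafInsertLeft : Letter → Tree Letter → Tree Letter
leafInsertLeft a (leaf _) = node (leaf tt) a (leaf tt)
leafInsertLeft a (node l b r) with a <? b
... | yes _ = node (leafInsertLeft a l) b r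
... | no  _ = node l b (leafInsertLeft a r)

leafInsertRight : Letter → Tree Letter → Tree Letter
leafInsertRight a (leaf _) = node (leaf tt) a (leaf tt)
leafInsertRight a (node l b r) with a ≤? b
... | yes _ = node (leafInsertRight a l) b r
... | no  _ = node l b (leafInsertRight a r)

𝖯 : Word → TreePair Letter
𝖯 u = List.foldl (λ t a → leafInsertLeft a t) (leaf tt) u
    , List.foldr leafInsertRight (leaf tt) u

-- A factorization of a nonempty word around its leftmost minimum (L a x = a < x,
-- R a x = a ≤ x) or its rightmost maximum (L b x = x ≤ b, R b x = x < b). It is
-- unique, whence the recursive equations incr-split and decr-split below.
data Pivot (L R : ℕ → ℕ → Set) : List ℕ → Set where
  empty : Pivot L R []
  split : ∀ v a w → All (L a) v → All (R a) w → Pivot L R (v ++ a ∷ w)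

private
  length-left : ∀ v (a : ℕ) w → length v < length (v ++ a ∷ w)
  length-left []      a w = s≤s z≤n
  length-left (_ ∷ v) a w = s≤s (length-left v a w)

  length-right : ∀ v (a : ℕ) w → length w < length (v ++ a ∷ w)
  length-right []      a w = ≤-refl
  length-right (_ ∷ v) a w = m≤n⇒m≤1+n (length-right v a w)

  grow : ∀ {L R} → (∀ u → Pivot L R u) → ∀ u → Acc _<_ (length u) → Tree ℕ
  grow pivot u (acc rs) with pivot u
  ... | empty           = leaf tt
  ... | split v a w _ _ = node (grow pivot v (rs (length-left v a w))) a
                               (grow pivot w (rs (length-right v a w)))

pivotTree : ∀ {L R} → (∀ u → Pivot L R u) → List ℕ → Tree ℕ
pivotTree pivot u = grow pivot u (<-wellFounded (length u))

leftmostMin : ∀ u → Pivot _<_ _≤_ u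
leftmostMin [] = empty
leftmostMin (x ∷ u) with leftmostMin u
... | empty = split [] x [] [] []
... | split v a w a<v a≤w with <-≤-connex a x
...   | inj₁ a<x = split (x ∷ v) a w (a<x ∷ a<v) a≤w
...   | inj₂ x≤a = split [] x (v ++ a ∷ w) []
  (All.++⁺ (All.map (λ a<y → ≤-trans x≤a (<⇒≤ a<y)) a<v) (x≤a ∷ All.map (≤-trans x≤a) a≤w))

rightmostMax : ∀ u → Pivot (λ b x → x ≤ b) (λ b x → x < b) u
rightmostMax [] = empty
rightmostMax (x ∷ u) with rightmostMax u
... | empty = split [] x [] [] []
... | split v b w v≤b w<b with ≤-<-connex x b
...   | inj₁ x≤b = split (x ∷ v) b w (x≤b ∷ v≤b) w<b
...   | inj₂ b<x = split [] x (v ++ b ∷ w) []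
  (All.++⁺ (All.map (λ y≤b → ≤-<-trans y≤b b<x) v≤b) (b<x ∷ All.map (λ y<b → <-trans y<b b<x) w<b))

incr decr : List ℕ → Tree ℕ
incr = pivotTree leftmostMin
decr = pivotTree rightmostMax

private
  module _ {L R : ℕ → ℕ → Set} (disjoint : ∀ {a x} → L a x → ¬ R x a) where

    ++-∷-unique : ∀ v {a w} v′ {a′ w′} →
      All (L a) v → All (R a) w → All (L a′) v′ → All (R a′) w′ →
      v ++ a ∷ w ≡ v′ ++ a′ ∷ w′ → v ≡ v′ × a ≡ a′ × w ≡ w′
    ++-∷-unique []      []       _  _  _  _  refl = refl , refl , refl
    ++-∷-unique []      (_ ∷ v′) _  rw (la′ ∷ _) _ refl with _ ∷ _ ← All.++⁻ʳ v′ rw =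
      ⊥-elim (disjoint la′ (All.head (All.++⁻ʳ v′ rw)))
    ++-∷-unique (_ ∷ v) []       (la ∷ _) _ _ rw′ refl =
      ⊥-elim (disjoint la (All.head (All.++⁻ʳ v rw′)))
    ++-∷-unique (x ∷ v) (_ ∷ v′) (_ ∷ lv) rw (_ ∷ lv′) rw′ eq with ∷-injective eq
    ... | refl , eq′ with ++-∷-unique v v′ lv rw lv′ rw′ eq′
    ...   | refl , refl , refl = refl , refl , refl

    grow-irrelevant : ∀ (pivot : ∀ u → Pivot L R u) u p q → grow pivot u p ≡ grow pivot u q
    grow-irrelevant pivot u (acc p) (acc q) with pivot u
    ... | empty = refl
    ... | split v a w _ _
      rewrite grow-irrelevant pivot v (p (length-left v a w)) (q (length-left v a w))
            | grow-irrelevant pivot w (p (length-right v a w)) (q (length-right v a w)) = refl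

    grow-split : ∀ (pivot : ∀ u → Pivot L R u) u v a w ac →
      u ≡ v ++ a ∷ w → All (L a) v → All (R a) w →
      grow pivot u ac ≡ node (pivotTree pivot v) a (pivotTree pivot w)
    grow-split pivot u v a w (acc rs) eq lv rw with pivot u
    grow-split pivot _ []      a w (acc rs) () lv rw | empty
    grow-split pivot _ (_ ∷ _) a w (acc rs) () lv rw | empty
    ... | split v′ a′ w′ lv′ rw′ with ++-∷-unique v′ v lv′ rw′ lv rw eq
    ...   | refl , refl , refl
      rewrite grow-irrelevant pivot v (rs (length-left v a w)) (<-wellFounded (length v))
            | grow-irrelevant pivot w (rs (length-right v a w)) (<-wellFounded (length w)) = refl

incr-[] : incr [] ≡ leaf tt
incr-[] = refl

incr-split : ∀ v a w → All (a <_) v → All (a ≤_) w →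
  incr (v ++ a ∷ w) ≡ node (incr v) a (incr w)
incr-split v a w a<v a≤w = grow-split <⇒≱ leftmostMin _ v a w (<-wellFounded _) refl a<v a≤w

decr-[] : decr [] ≡ leaf tt
decr-[] = refl

decr-split : ∀ v b w → All (_≤ b) v → All (_< b) w →
  decr (v ++ b ∷ w) ≡ node (decr v) b (decr w)
decr-split v b w v≤b w<b = grow-split ≤⇒≯ rightmostMax _ v b w (<-wellFounded _) refl v≤b w<b

𝖰 : Word → TreePair ℕ
𝖰 u = incr (permutationWord (flip (std u))) , decr (permutationWord (flip (std u)))

record IsTwinBST (T : TreePair Letter) : Set where
  field
    twin         : IsTwin T
    leftBST      : IsLeftBST (proj₁ T)
    rightBST     : IsRightBST (proj₂ T)
    same-inorder : inorder (proj₁ T) ≡ inorder (proj₂ T)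

record IsTwinIncrDecr (S : TreePair ℕ) : Set where
  field
    twin         : IsTwin S
    increasing   : IsIncreasing (proj₁ S)
    decreasing   : IsDecreasing (proj₂ S)
    same-inorder : inorder (proj₁ S) ≡ inorder (proj₂ S)

record IsBaxterPair (TS : TreePair Letter × TreePair ℕ) : Set where
  field
    twinBST      : IsTwinBST (proj₁ TS)
    twinIncrDecr : IsTwinIncrDecr (proj₂ TS)
    same-shape   : pairShape (proj₁ TS) ≡ pairShape (proj₂ TS)

-- Two elements are the same when their first components are: the proof that the
-- conditions hold is not part of the data.
BaxterPair : Set
BaxterPair = Σ (TreePair Letter × TreePair ℕ) IsBaxterPair

{-# OPTIONS --safe #-}
-- Label every letter of u with its position and order the pairs (letter, position)
-- lexicographically. Both leaf insertions are then the same insertion into a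
-- binary search tree of pairs: equal letters are compared by position, which
-- increases along the insertions for T_L and decreases for T_R. The two trees of
-- pairs have the same inorder reading, the sorted list of pairs. Forgetting the
-- positions gives 𝖯 u. Forgetting the letters gives trees that are heap ordered for
-- the order of insertion and whose inorder reading is std(u)⁻¹, that is 𝖰 u.
--
-- The canopy of an increasing (decreasing) tree records the ascents (descents) of
-- its inorder reading, so increasing and decreasing trees with the same reading
-- are twins. Conversely, a left binary search tree and an increasing tree of the
-- same shape superpose to a tree of pairs whose inorder reading is sorted, and the
-- letters listed by position form the preimage.
module Submission where

open import Defs
open import Data.Nat.Base using (ℕ; zero; suc; _+_; _∸_; _<_; _≤_; _>_; z<s; s≤s)
open import Data.Nat.Properties
  using (_≟_; ≤-refl; suc-injective; _<?_; _≤?_; <-cmp; <-trans; <-asym; <-irrefl; <⇒≤;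
         ≤∧≢⇒<; <-isStrictTotalOrder; <-resp₂-≡)
open import Data.Fin.Base as Fin using (Fin; zero; suc; toℕ)
open import Data.Fin.Patterns using (0F; 1F)
import Data.Fin.Properties as Fin
open import Data.Fin.Permutation using (_⟨$⟩ʳ_; _⟨$⟩ˡ_; inverseˡ; inverseʳ; flip)
open import Data.List.Base
  using (List; []; _∷_; _++_; map; length; lookup; tabulate; foldr; foldl; reverse; take; drop; upTo; applyUpTo)
open import Data.List.Properties
  using (length-++; length-map; length-upTo; map-++; map-tabulate; tabulate-lookup; map-upTo;
         unfold-reverse; reverse-foldr; reverse-map; ++-assoc; ∷-injective; ∷-injectiveˡ; ∷-injectiveʳ)
open import Data.List.Membership.Propositional using (_∈_)
open import Data.List.Membership.Propositional.Properties using (∈-tabulate⁺; ∈-tabulate⁻)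
open import Data.List.Relation.Unary.All as All using (All; []; _∷_)
import Data.List.Relation.Unary.All.Properties as All
open import Data.List.Relation.Unary.Any using (here; there)
open import Data.List.Relation.Unary.AllPairs using (AllPairs; []; _∷_)
import Data.List.Relation.Unary.AllPairs.Properties as AllPairs
open import Data.List.Relation.Unary.Unique.Propositional using (Unique)
import Data.List.Relation.Unary.Unique.Propositional.Properties as Unique
open import Data.List.Relation.Binary.Pointwise using (Pointwise; []; _∷_)
open import Data.List.Relation.Binary.Permutation.Propositional
  using (_↭_; ↭-refl; ↭-sym; ↭-trans; ↭-reflexive; ↭⇒↭ₛ; prep)
open import Data.List.Relation.Binary.Permutation.Propositional.Properties
  using (All-resp-↭; ∈-resp-↭; shift; ++⁺ˡ; ++⁺ʳ; ↭-reverse; ↭-length; ↭-map-inv) renaming (map⁺ to ↭-map⁺)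
import Data.List.Relation.Binary.Permutation.Setoid.Properties as ↭-Setoid
open import Data.Tree.Binary using (leaf; node; #nodes; mapₙ; module Infix)
open import Data.Tree.Binary.Properties using (#nodes-mapₙ; map-compose)
import Data.Tree.Binary.Relation.Unary.All as Tree
import Data.Tree.Binary.Relation.Unary.All.Properties as Tree
open import Data.Product.Base using (Σ; ∃; _×_; _,_; proj₁; proj₂)
open import Data.Product.Relation.Binary.Lex.Strict using (×-Lex; ×-decidable; ×-asymmetric; ×-transitive; ×-compare)
open import Data.Sum.Base using (inj₁; inj₂)
open import Data.Unit.Base using (tt)
open import Data.Empty using (⊥-elim)
open import Function.Base using (_on_; _∘_)
open import Function.Bundles using (Equivalence)
open import Function.Definitions using (Bijective; Injective; Surjective)
open import Level using (0ℓ)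
open import Relation.Nullary using (¬_; Dec; yes; no)
open import Relation.Binary.Core using (Rel)
open import Relation.Binary.Definitions using (Asymmetric; Transitive; Irreflexive; Tri; tri<; tri≈; tri>)
open import Relation.Binary.Structures using (IsStrictTotalOrder)
import Relation.Binary.Construct.Flip.EqAndOrd as Flip
open import Relation.Binary.PropositionalEquality
  using (_≡_; _≢_; refl; sym; trans; cong; cong₂; subst; subst₂; setoid; isEquivalence; module ≡-Reasoning)

-- Lists

module _ {A : Set} {_≺_ : Rel A 0ℓ} (≺-asym : Asymmetric _≺_) where

  -- If the heads differed, each would occur in the tail of the other list and so precede the other,
  -- against asymmetry. For the same reason a head does not recur in its own tail, and membership
  -- passes to the tails.
  sorted-unique : ∀ {xs ys} → AllPairs _≺_ xs → AllPairs _≺_ ys →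
    (∀ {z} → z ∈ xs → z ∈ ys) → (∀ {z} → z ∈ ys → z ∈ xs) → xs ≡ ys
  sorted-unique []      []      _  _  = refl
  sorted-unique []      (_ ∷ _) _  ys⊆xs with () ← ys⊆xs (here refl)
  sorted-unique (_ ∷ _) []      xs⊆ys _ with () ← xs⊆ys (here refl)
  sorted-unique {x ∷ xs} {y ∷ ys} (x≺xs ∷ sxs) (y≺ys ∷ sys) xs⊆ys ys⊆xs =
    cong₂ _∷_ x≡y (sorted-unique sxs sys to from)
    where
    x≡y : x ≡ y
    x≡y with xs⊆ys (here refl) | ys⊆xs (here refl)
    ... | here eq    | _          = eq
    ... | there _    | here eq    = sym eq
    ... | there x∈ys | there y∈xs = ⊥-elim (≺-asym (All.lookup x≺xs y∈xs) (All.lookup y≺ys x∈ys))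

    to : ∀ {z} → z ∈ xs → z ∈ ys
    to z∈xs with xs⊆ys (there z∈xs)
    ... | there z∈ys = z∈ys
    ... | here refl with x≺z ← All.lookup x≺xs z∈xs rewrite x≡y = ⊥-elim (≺-asym x≺z x≺z)

    from : ∀ {z} → z ∈ ys → z ∈ xs
    from z∈ys with ys⊆xs (there z∈ys)
    ... | there z∈xs = z∈xs
    ... | here refl with y≺z ← All.lookup y≺ys z∈ys rewrite x≡y = ⊥-elim (≺-asym y≺z y≺z)

  sorted-↭⇒≡ : ∀ {xs ys} → AllPairs _≺_ xs → AllPairs _≺_ ys → xs ↭ ys → xs ≡ ys
  sorted-↭⇒≡ sxs sys xs↭ys = sorted-unique sxs sys (∈-resp-↭ xs↭ys) (∈-resp-↭ (↭-sym xs↭ys))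

AllPairs-reverse : ∀ {A : Set} {R : Rel A 0ℓ} {xs} → AllPairs R xs → AllPairs (λ x y → R y x) (reverse xs)
AllPairs-reverse [] = []
AllPairs-reverse {R = R} {x ∷ xs} (rx ∷ rxs) rewrite unfold-reverse x xs =
  AllPairs.++⁺ (AllPairs-reverse rxs) ([] ∷ [])
    (All-resp-↭ (↭-sym (↭-reverse xs)) (All.map (_∷ []) rx))

projections-injective : ∀ {A B : Set} {xs ys : List (A × B)} →
  map proj₁ xs ≡ map proj₁ ys → map proj₂ xs ≡ map proj₂ ys → xs ≡ ys
projections-injective {xs = []}    {[]}    _ _ = refl
projections-injective {xs = _ ∷ _} {_ ∷ _} eq₁ eq₂ =
  cong₂ _∷_ (cong₂ _,_ (∷-injectiveˡ eq₁) (∷-injectiveˡ eq₂))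
            (projections-injective (∷-injectiveʳ eq₁) (∷-injectiveʳ eq₂))

tabulate-toℕ : ∀ {A : Set} n (f : ℕ → A) → tabulate {n = n} (f ∘ toℕ) ≡ applyUpTo f n
tabulate-toℕ zero    f = refl
tabulate-toℕ (suc n) f = cong (f 0 ∷_) (tabulate-toℕ n (f ∘ suc))

++-∷-injective : ∀ {A : Set} (xs ys : List A) {x y xs′ ys′} → length xs ≡ length ys →
  xs ++ x ∷ xs′ ≡ ys ++ y ∷ ys′ → xs ≡ ys × x ≡ y × xs′ ≡ ys′
++-∷-injective []       []       _   eq = refl , ∷-injective eq
++-∷-injective (x ∷ xs) (y ∷ ys) len eq with ++-∷-injective xs ys (cong (_∸ 1) len) (∷-injectiveʳ eq)
... | xs≡ys , rest = cong₂ _∷_ (∷-injectiveˡ eq) xs≡ys , rest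

-- Trees

toDiffList-++ : ∀ {A} (t : Tree A) xs → Infix.toDiffList t xs ≡ inorder t ++ xs
toDiffList-++ (leaf _)     xs = refl
toDiffList-++ (node l x r) xs = begin
  Infix.toDiffList l (x ∷ Infix.toDiffList r xs)     ≡⟨ toDiffList-++ l _ ⟩
  inorder l ++ x ∷ Infix.toDiffList r xs             ≡⟨ cong (λ ys → inorder l ++ x ∷ ys) (toDiffList-++ r xs) ⟩
  inorder l ++ (x ∷ inorder r) ++ xs                 ≡⟨ ++-assoc (inorder l) _ xs ⟨
  (inorder l ++ x ∷ inorder r) ++ xs                 ≡⟨ cong (_++ xs) (toDiffList-++ l _) ⟨
  inorder (node l x r) ++ xs                         ∎
  where open ≡-Reasoning

inorder-node : ∀ {A} (l : Tree A) x r → inorder (node l x r) ≡ inorder l ++ x ∷ inorder r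
inorder-node l x r = toDiffList-++ l _

inorder-mapₙ : ∀ {A B} (f : A → B) (t : Tree A) → inorder (mapₙ f t) ≡ map f (inorder t)
inorder-mapₙ f (leaf _) = refl
inorder-mapₙ f (node l x r)
  rewrite inorder-node (mapₙ f l) (f x) (mapₙ f r) | inorder-node l x r
        | inorder-mapₙ f l | inorder-mapₙ f r = sym (map-++ f (inorder l) _)

length-inorder : ∀ {A} (t : Tree A) → length (inorder t) ≡ #nodes t
length-inorder (leaf _) = refl
length-inorder (node l x r) rewrite inorder-node l x r | length-++ (inorder l) {x ∷ inorder r} =
  cong₂ (λ m n → m + suc n) (length-inorder l) (length-inorder r)

shape-mapₙ : ∀ {A B} (f : A → B) (t : Tree A) → shape (mapₙ f t) ≡ shape t
shape-mapₙ f t = sym (map-compose t)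

node-injective : ∀ {A} {l l′ : Tree A} {x x′ r r′} → node l x r ≡ node l′ x′ r′ → l ≡ l′ × r ≡ r′
node-injective refl = refl , refl

shape⇒length : ∀ {A B} (s : Tree A) (t : Tree B) → shape s ≡ shape t → length (inorder s) ≡ length (inorder t)
shape⇒length s t eq = begin
  length (inorder s)   ≡⟨ length-inorder s ⟩
  #nodes s             ≡⟨ #nodes-mapₙ _ s ⟨
  #nodes (shape s)     ≡⟨ cong #nodes eq ⟩
  #nodes (shape t)     ≡⟨ #nodes-mapₙ _ t ⟩
  #nodes t             ≡⟨ length-inorder t ⟨
  length (inorder t)   ∎
  where open ≡-Reasoning

-- Equal shapes give left subtrees of equal size, so that both readings are cut around the root at
-- the same place.
shape-inorder-injective : ∀ {A} (s t : Tree A) → shape s ≡ shape t → inorder s ≡ inorder t → s ≡ t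
shape-inorder-injective (leaf _)     (leaf _)        _  _ = refl
shape-inorder-injective (node l x r) (node l′ x′ r′) sh eq
  with shₗ , shᵣ ← node-injective sh
  with eqₗ , eqₓ , eqᵣ ← ++-∷-injective (inorder l) (inorder l′) (shape⇒length l l′ shₗ)
         (trans (sym (inorder-node l x r)) (trans eq (inorder-node l′ x′ r′)))
  rewrite shape-inorder-injective l l′ shₗ eqₗ | eqₓ | shape-inorder-injective r r′ shᵣ eqᵣ = refl

-- Rebuilds a tree of pairs (letter, position) from a tree of letters and a tree of positions.
superpose : ∀ {A B} (s : Tree A) (t : Tree B) → shape s ≡ shape t →
  ∃ λ z → mapₙ proj₁ z ≡ s × mapₙ proj₂ z ≡ t
superpose (leaf _)     (leaf _)        _  = leaf tt , refl , refl
superpose (node l x r) (node l′ x′ r′) sh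
  with shₗ , shᵣ ← node-injective sh
  with zₗ , refl , refl ← superpose l l′ shₗ
  with zᵣ , refl , refl ← superpose r r′ shᵣ = node zₗ (x , x′) zᵣ , refl , refl

module _ {A : Set} {P : A → Set} where

  AllLabels⇒inorder : ∀ {t} → AllLabels P t → All P (inorder t)
  AllLabels⇒inorder (Tree.leaf _) = []
  AllLabels⇒inorder (Tree.node {l = l} {x} {r} pl px pr) rewrite inorder-node l x r =
    All.++⁺ (AllLabels⇒inorder pl) (px ∷ AllLabels⇒inorder pr)

  inorder⇒AllLabels : ∀ t → All P (inorder t) → AllLabels P t
  inorder⇒AllLabels (leaf _) _ = Tree.leaf tt
  inorder⇒AllLabels (node l x r) p
    with pl , px ∷ pr ← All.++⁻ (inorder l) (subst (All P) (inorder-node l x r) p) =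
    Tree.node (inorder⇒AllLabels l pl) px (inorder⇒AllLabels r pr)

  AllLabels-map⁻ : ∀ {B} {f : B → A} t → AllLabels P (mapₙ f t) → AllLabels (P ∘ f) t
  AllLabels-map⁻ (leaf _)     _                  = Tree.leaf tt
  AllLabels-map⁻ (node l x r) (Tree.node pl px pr) = Tree.node (AllLabels-map⁻ l pl) px (AllLabels-map⁻ r pr)

  AllLabels-zip : ∀ {Q : A → Set} {t} → AllLabels P t → AllLabels Q t → AllLabels (λ x → P x × Q x) t
  AllLabels-zip (Tree.leaf _)       (Tree.leaf _)       = Tree.leaf tt
  AllLabels-zip (Tree.node pl p pr) (Tree.node ql q qr) =
    Tree.node (AllLabels-zip pl ql) (p , q) (AllLabels-zip pr qr)

  AllLabels⇒RootSatisfies : ∀ {t} → AllLabels P t → RootSatisfies P t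
  AllLabels⇒RootSatisfies (Tree.leaf _)     = leaf
  AllLabels⇒RootSatisfies (Tree.node _ p _) = node p

AllLabels-mono : ∀ {A} {P Q : A → Set} → (∀ {x} → P x → Q x) → ∀ {t} → AllLabels P t → AllLabels Q t
AllLabels-mono f = Tree.mapₙ f

AllLabels-map⁺ : ∀ {A B} {P : B → Set} (f : A → B) {t} → AllLabels (P ∘ f) t → AllLabels P (mapₙ f t)
AllLabels-map⁺ f = Tree.mapₙ⁺ f

-- Heap-ordered trees

RootSatisfies-mono : ∀ {A} {P Q : A → Set} → (∀ {x} → P x → Q x) → ∀ {t} → RootSatisfies P t → RootSatisfies Q t
RootSatisfies-mono f leaf     = leaf
RootSatisfies-mono f (node p) = node (f p)

-- Transitivity carries the bound `a` down every edge; this turns the local heap condition into one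
-- on all descendants.
ParentChild⇒AllLabels : ∀ {A} {R : Rel A 0ℓ} → Transitive R → ∀ {a t} →
  RootSatisfies (R a) t → ParentChild R t → AllLabels (R a) t
ParentChild⇒AllLabels R-trans leaf       leaf               = Tree.leaf tt
ParentChild⇒AllLabels R-trans (node Rax) (node Rxl Rxr hl hr) = Tree.node
  (ParentChild⇒AllLabels R-trans (RootSatisfies-mono (R-trans Rax) Rxl) hl)
  Rax
  (ParentChild⇒AllLabels R-trans (RootSatisfies-mono (R-trans Rax) Rxr) hr)

-- The root of a heap-ordered tree is smaller than all its descendants, so it is the pivot at which
-- `incr` cuts the inorder reading.
incr-inorder : ∀ {t} → ParentChild _<_ t → incr (inorder t) ≡ t
incr-inorder leaf = refl
incr-inorder (node {l} {a} {r} al ar hl hr)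
  rewrite inorder-node l a r
        | incr-split (inorder l) a (inorder r)
            (AllLabels⇒inorder (ParentChild⇒AllLabels <-trans al hl))
            (All.map <⇒≤ (AllLabels⇒inorder (ParentChild⇒AllLabels <-trans ar hr)))
        | incr-inorder hl | incr-inorder hr = refl

>-isStrictTotalOrder : IsStrictTotalOrder _≡_ _>_
>-isStrictTotalOrder = Flip.isStrictTotalOrder <-isStrictTotalOrder

decr-inorder : ∀ {t} → ParentChild _>_ t → decr (inorder t) ≡ t
decr-inorder leaf = refl
decr-inorder (node {l} {a} {r} al ar hl hr)
  rewrite inorder-node l a r
        | decr-split (inorder l) a (inorder r)
            (All.map <⇒≤ (AllLabels⇒inorder (ParentChild⇒AllLabels (IsStrictTotalOrder.trans >-isStrictTotalOrder) al hl)))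
            (AllLabels⇒inorder (ParentChild⇒AllLabels (IsStrictTotalOrder.trans >-isStrictTotalOrder) ar hr))
        | decr-inorder hl | decr-inorder hr = refl
-- Canopies

leafSides-mapₙ : ∀ {A B} (f : A → B) s (t : Tree A) → leafSides s (mapₙ f t) ≡ leafSides s t
leafSides-mapₙ f s (leaf _)     = refl
leafSides-mapₙ f s (node l _ r) = cong₂ _++_ (leafSides-mapₙ f 1F l) (leafSides-mapₙ f 0F r)

canopy-mapₙ : ∀ {A B} (f : A → B) (t : Tree A) → canopy (mapₙ f t) ≡ canopy t
canopy-mapₙ f t = cong₂ (λ n ss → take (n ∸ 1) (drop 1 ss)) (#nodes-mapₙ f t) (leafSides-mapₙ f 0F t)

-- `R` goes from ancestor to descendant: it is `_<_` for increasing trees and `_>_` for decreasing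
-- ones, and one argument serves both.
module Steps {R : Rel ℕ 0ℓ} (sto : IsStrictTotalOrder _≡_ R) where
  private module R = IsStrictTotalOrder sto

  step : ℕ → ℕ → Fin 2
  step x y with x R.<? y
  ... | yes _ = 1F
  ... | no  _ = 0F

  step-yes : ∀ {x y} → R x y → step x y ≡ 1F
  step-yes {x} {y} Rxy with x R.<? y
  ... | yes _   = refl
  ... | no ¬Rxy = ⊥-elim (¬Rxy Rxy)

  step-no : ∀ {x y} → ¬ R x y → step x y ≡ 0F
  step-no {x} {y} ¬Rxy with x R.<? y
  ... | yes Rxy = ⊥-elim (¬Rxy Rxy)
  ... | no _    = refl

  -- The sentinels `p` and `q` stand before and after the word: `n` letters then have `n + 1` steps,
  -- one for each leaf of a tree with `n` nodes.
  steps : ℕ → List ℕ → ℕ → List (Fin 2)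
  steps p []       q = step p q ∷ []
  steps p (x ∷ xs) q = step p x ∷ steps x xs q

  steps-++ : ∀ p xs x ys q → steps p (xs ++ x ∷ ys) q ≡ steps p xs x ++ steps x ys q
  steps-++ p []       x ys q = refl
  steps-++ p (_ ∷ xs) x ys q = cong (_ ∷_) (steps-++ _ xs x ys q)

  -- The labels p and q are those of the neighbours of t in the inorder reading of
  -- the tree from which t hangs: both are ancestors of t, and the leaf between two
  -- neighbours is a left child exactly when the second descends from the first.
  leafSides-steps : ∀ {p q s t} → ParentChild R t → AllLabels (R p) t → AllLabels (R q) t →
    s ≡ step p q → leafSides s t ≡ steps p (inorder t) q
  leafSides-steps leaf _ _ refl = refl
  leafSides-steps {p} {q} (node {l} {x} {r} xl xr hl hr) (Tree.node pl px pr) (Tree.node ql qx qr) _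
    rewrite inorder-node l x r | steps-++ p (inorder l) x (inorder r) q =
    cong₂ _++_
      (leafSides-steps hl pl (ParentChild⇒AllLabels R.trans xl hl) (sym (step-yes px)))
      (leafSides-steps hr (ParentChild⇒AllLabels R.trans xr hr) qr (sym (step-no (R.asym qx))))

  -- With the same sentinel at both ends, `step b b` is `0F` by irreflexivity, which is the side
  -- that `canopy` gives to the whole tree.
  canopy-steps : ∀ {b t} → ParentChild R t → AllLabels (R b) t →
    canopy t ≡ take (length (inorder t) ∸ 1) (drop 1 (steps b (inorder t) b))
  canopy-steps {t = t} h bt = cong₂ (λ n ss → take (n ∸ 1) (drop 1 ss)) (sym (length-inorder t))
    (leafSides-steps h bt bt (sym (step-no (R.irrefl refl))))

module Ascents = Steps <-isStrictTotalOrder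
module Descents = Steps >-isStrictTotalOrder

step-opposite : ∀ {x y} → x ≢ y → Ascents.step x y ≢ Descents.step x y
step-opposite {x} {y} x≢y = opposite (<-cmp x y)
  where
  opposite : Tri (x < y) (x ≡ y) (x > y) → Ascents.step x y ≢ Descents.step x y
  opposite (tri≈ _ x≡y _)   _  = x≢y x≡y
  opposite (tri< x<y _ x≯y) eq with () ← trans (sym (Ascents.step-yes x<y)) (trans eq (Descents.step-no x≯y))
  opposite (tri> x≮y _ x>y) eq with () ← trans (sym (Ascents.step-no x≮y)) (trans eq (Descents.step-yes x>y))

-- Two equal neighbours would give `0F` for both orders, whence `Unique`. The last step, towards the
-- sentinels `p` and `q`, is cut off by `take`, so the sentinels may differ.
steps-opposite : ∀ {x xs} p q → Unique (x ∷ xs) →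
  Pointwise _≢_ (take (length xs) (Ascents.steps x xs p)) (take (length xs) (Descents.steps x xs q))
steps-opposite {xs = []}    p q _                    = []
steps-opposite {xs = _ ∷ _} p q ((x≢y ∷ _) ∷ unique) = step-opposite x≢y ∷ steps-opposite p q unique

increasing-decreasing⇒twin : ∀ s t → IsIncreasing s → IsDecreasing t → inorder s ≡ inorder t → IsTwin (s , t)
increasing-decreasing⇒twin s t (s↭ , hs) (t↭ , ht) s≡t = record
  { same-size         = trans (#nodes-mapₙ _ s) (trans size (sym (#nodes-mapₙ _ t)))
  ; canopies-opposite = subst₂ (Pointwise _≢_)
      (sym (trans (canopy-mapₙ _ s) (Ascents.canopy-steps hs positive)))
      (sym (trans (canopy-mapₙ _ t) (trans (Descents.canopy-steps ht bounded)
        (cong (λ xs → take (length xs ∸ 1) (drop 1 (Descents.steps bound xs bound))) (sym s≡t)))))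
      (opposite (inorder s) (↭-Setoid.Unique-resp-↭ (setoid ℕ) (↭⇒↭ₛ (↭-sym s↭))
        (Unique.map⁺ suc-injective (Unique.upTo⁺ _))))
  }
  where
  -- The sentinel for `t`, above all labels `1, …, n`. The one for `s` is `0`, below all of them.
  bound = suc (#nodes t)

  size : #nodes s ≡ #nodes t
  size = trans (sym (length-inorder s)) (trans (cong length s≡t) (length-inorder t))

  positive : AllLabels (0 <_) s
  positive = inorder⇒AllLabels s (All-resp-↭ (↭-sym s↭) (All.map⁺ (All.map (λ _ → z<s) (All.all-upTo _))))

  bounded : AllLabels (bound >_) t
  bounded = inorder⇒AllLabels t (All-resp-↭ (↭-sym t↭) (All.map⁺ (All.map s≤s (All.all-upTo _))))

  opposite : ∀ xs → Unique xs → Pointwise _≢_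
    (take (length xs ∸ 1) (drop 1 (Ascents.steps 0 xs 0)))
    (take (length xs ∸ 1) (drop 1 (Descents.steps bound xs bound)))
  opposite []      _      = []
  opposite (_ ∷ _) unique = steps-opposite 0 bound unique

standardLabeled : ∀ n t → inorder t ↭ map suc (upTo n) → IsStandardLabeled t
standardLabeled n t p = subst (λ m → inorder t ↭ map suc (upTo m)) n≡#nodes p
  where
  open ≡-Reasoning
  n≡#nodes : n ≡ #nodes t
  n≡#nodes = begin
    n                           ≡⟨ length-upTo n ⟨
    length (upTo n)             ≡⟨ length-map suc (upTo n) ⟨
    length (map suc (upTo n))   ≡⟨ ↭-length p ⟨
    length (inorder t)          ≡⟨ length-inorder t ⟩
    #nodes t                    ∎

-- Trees of letters with their positions

Label : Set
Label = Letter × ℕ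

_≺_ : Rel Label 0ℓ
_≺_ = ×-Lex _≡_ _<_ _<_

≺-asym : Asymmetric _≺_
≺-asym = ×-asymmetric {_<₂_ = _<_} sym <-resp₂-≡ <-asym <-asym

≺-trans : Transitive _≺_
≺-trans = ×-transitive {_<₂_ = _<_} isEquivalence <-resp₂-≡ <-trans <-trans

⊀⇒≻ : ∀ {x y} → proj₂ x ≢ proj₂ y → ¬ x ≺ y → y ≺ x
⊀⇒≻ {x} {y} x≢y x⊀y with ×-compare {_≈₂_ = _≡_} sym <-cmp <-cmp x y
... | tri< x≺y _ _     = ⊥-elim (x⊀y x≺y)
... | tri≈ _ (_ , x≡y) _ = ⊥-elim (x≢y x≡y)
... | tri> _ _ y≺x     = y≺x

-- Abstract, so that a with-abstraction of proj₁ x <? proj₁ y cannot reach inside.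
abstract
  _≺?_ : ∀ x y → Dec (x ≺ y)
  _≺?_ = ×-decidable _≟_ _<?_ _<?_

insert : Label → Tree Label → Tree Label
insert x (leaf _) = node (leaf tt) x (leaf tt)
insert x (node l y r) with x ≺? y
... | yes _ = node (insert x l) y r
... | no  _ = node l y (insert x r)

insertAll : List Label → Tree Label
insertAll = foldr insert (leaf tt)

inorder-insert : ∀ x t → inorder (insert x t) ↭ x ∷ inorder t
inorder-insert x (leaf _) = ↭-refl
inorder-insert x (node l y r) with x ≺? y
... | yes _ rewrite inorder-node (insert x l) y r | inorder-node l y r =
  ++⁺ʳ (y ∷ inorder r) (inorder-insert x l)
... | no  _ rewrite inorder-node l y (insert x r) | inorder-node l y r =
  ↭-trans (++⁺ˡ (inorder l) (↭-trans (prep y (inorder-insert x r)) (shift x (y ∷ []) (inorder r))))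
          (shift x (inorder l) (y ∷ inorder r))

inorder-insertAll : ∀ xs → inorder (insertAll xs) ↭ xs
inorder-insertAll []       = ↭-refl
inorder-insertAll (x ∷ xs) = ↭-trans (inorder-insert x (insertAll xs)) (prep x (inorder-insertAll xs))

AllLabels-insert : ∀ {P : Label → Set} {x t} → P x → AllLabels P t → AllLabels P (insert x t)
AllLabels-insert {P} {x} {t} px pt =
  inorder⇒AllLabels _ (All-resp-↭ (↭-sym (inorder-insert x t)) (px ∷ AllLabels⇒inorder pt))

AllLabels-insertAll : ∀ {P : Label → Set} {xs} → All P xs → AllLabels P (insertAll xs)
AllLabels-insertAll {xs = xs} p = inorder⇒AllLabels _ (All-resp-↭ (↭-sym (inorder-insertAll xs)) p)

-- A treap with the positions as priorities: search order `_≺_` on the pairs and heap order `R` on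
-- the positions, both imposed on all descendants.
data Treap (R : Rel ℕ 0ℓ) : Tree Label → Set where
  leaf : Treap R (leaf tt)
  node : ∀ {l x r} →
    AllLabels (λ y → y ≺ x × R (proj₂ x) (proj₂ y)) l →
    AllLabels (λ y → x ≺ y × R (proj₂ x) (proj₂ y)) r →
    Treap R l → Treap R r → Treap R (node l x r)

module _ {R : Rel ℕ 0ℓ} (irrefl : Irreflexive _≡_ R) where

  -- The new position comes `R`-after all those present, so the new leaf may hang below any node. By
  -- irreflexivity it differs from each of them, so that a failed test `x ≺? y` yields `y ≺ x`.
  insert-treap : ∀ {x t} → AllLabels (λ y → R (proj₂ y) (proj₂ x)) t → Treap R t → Treap R (insert x t)
  insert-treap (Tree.leaf _) leaf = node (Tree.leaf tt) (Tree.leaf tt) leaf leaf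
  insert-treap {x} {node _ y _} (Tree.node al Ryx ar) (node yl yr tl tr) with x ≺? y
  ... | yes x≺y = node (AllLabels-insert (x≺y , Ryx) yl) yr (insert-treap al tl) tr
  ... | no  x⊀y = node yl (AllLabels-insert (⊀⇒≻ (λ x≡y → irrefl (sym x≡y) Ryx) x⊀y , Ryx) yr)
                       tl (insert-treap ar tr)

  -- `foldr` inserts the head of the list last, whence the reversed arguments of `R`.
  insertAll-treap : ∀ {xs} → AllPairs (λ x y → R (proj₂ y) (proj₂ x)) xs → Treap R (insertAll xs)
  insertAll-treap []         = leaf
  insertAll-treap (rx ∷ rxs) = insert-treap (AllLabels-insertAll rx) (insertAll-treap rxs)

treap-sorted : ∀ {R t} → Treap R t → AllPairs _≺_ (inorder t)
treap-sorted leaf = []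
treap-sorted (node {l} {x} {r} xl xr tl tr) rewrite inorder-node l x r =
  AllPairs.++⁺ (treap-sorted tl) (x≺r ∷ treap-sorted tr)
    (All.map (λ y≺x → y≺x ∷ All.map (≺-trans y≺x) x≺r) l≺x)
  where
  l≺x : All (_≺ x) (inorder l)
  l≺x = All.map proj₁ (AllLabels⇒inorder xl)

  x≺r : All (x ≺_) (inorder r)
  x≺r = All.map proj₁ (AllLabels⇒inorder xr)

treap-parentChild : ∀ {R t} → Treap R t → ParentChild R (mapₙ proj₂ t)
treap-parentChild leaf = leaf
treap-parentChild (node xl xr tl tr) =
  node (root (AllLabels-mono proj₂ xl)) (root (AllLabels-mono proj₂ xr))
       (treap-parentChild tl) (treap-parentChild tr)
  where
  root : ∀ {Q : ℕ → Set} {t} → AllLabels (Q ∘ proj₂) t → RootSatisfies Q (mapₙ proj₂ t)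
  root q = AllLabels⇒RootSatisfies (AllLabels-map⁺ proj₂ q)

-- Treaps and binary search trees of letters

≺⇒≤ : ∀ {x y} → x ≺ y → proj₁ x ≤ proj₁ y
≺⇒≤ (inj₁ a<b)        = <⇒≤ a<b
≺⇒≤ (inj₂ (refl , _)) = ≤-refl

≺⇒< : ∀ {x y} → x ≺ y → ¬ proj₂ x < proj₂ y → proj₁ x < proj₁ y
≺⇒< (inj₁ a<b)       _   = a<b
≺⇒< (inj₂ (_ , i<j)) i≮j = ⊥-elim (i≮j i<j)

≤⇒≺ : ∀ {x y} → proj₁ x ≤ proj₁ y → proj₂ x < proj₂ y → x ≺ y
≤⇒≺ {a , _} {b , _} a≤b i<j with a ≟ b
... | yes a≡b = inj₂ (a≡b , i<j)
... | no  a≢b = inj₁ (≤∧≢⇒< a≤b a≢b)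

-- The heap order decides where ties fall: a descendant with the same letter as its ancestor has a
-- larger position, hence follows it in `_≺_` and lies to its right. With `_>_` ties fall to the
-- left.
treap-leftBST : ∀ {t} → Treap _<_ t → IsLeftBST (mapₙ proj₁ t)
treap-leftBST leaf = leaf
treap-leftBST (node xl xr tl tr) = node
  (AllLabels-map⁺ proj₁ (AllLabels-mono (λ { (y≺x , i<j) → ≺⇒< y≺x (<-asym i<j) }) xl))
  (AllLabels-map⁺ proj₁ (AllLabels-mono (≺⇒≤ ∘ proj₁) xr))
  (treap-leftBST tl) (treap-leftBST tr)

treap-rightBST : ∀ {t} → Treap _>_ t → IsRightBST (mapₙ proj₁ t)
treap-rightBST leaf = leaf
treap-rightBST (node xl xr tl tr) = node
  (AllLabels-map⁺ proj₁ (AllLabels-mono (≺⇒≤ ∘ proj₁) xl))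
  (AllLabels-map⁺ proj₁ (AllLabels-mono (λ { (x≺y , i>j) → ≺⇒< x≺y (<-asym i>j) }) xr))
  (treap-rightBST tl) (treap-rightBST tr)

-- A left binary search tree has ties only to the right, where positions grow downwards, so a tie
-- there is ordered by `_≺_`.
leftBST-increasing⇒treap : ∀ z → IsLeftBST (mapₙ proj₁ z) → ParentChild _<_ (mapₙ proj₂ z) → Treap _<_ z
leftBST-increasing⇒treap (leaf _) _ _ = leaf
leftBST-increasing⇒treap (node l x r) (node bl br sl sr) (node il ir hl hr) = node
  (AllLabels-mono (λ { (b<a , i<j) → inj₁ b<a , i<j })
    (AllLabels-zip (AllLabels-map⁻ l bl) (AllLabels-map⁻ l (ParentChild⇒AllLabels <-trans il hl))))
  (AllLabels-mono (λ { (a≤b , i<j) → ≤⇒≺ a≤b i<j , i<j })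
    (AllLabels-zip (AllLabels-map⁻ r br) (AllLabels-map⁻ r (ParentChild⇒AllLabels <-trans ir hr))))
  (leftBST-increasing⇒treap l sl hl) (leftBST-increasing⇒treap r sr hr)

-- The new label has the largest position, so at an equal letter it goes right, as the strict test
-- of `leafInsertLeft` prescribes. Hence the two tests always agree.
leafInsertLeft-insert : ∀ x t → AllLabels (λ y → proj₂ y < proj₂ x) t →
  mapₙ proj₁ (insert x t) ≡ leafInsertLeft (proj₁ x) (mapₙ proj₁ t)
leafInsertLeft-insert x (leaf _) _ = refl
leafInsertLeft-insert x (node l y r) (Tree.node al j<i ar) with x ≺? y | proj₁ x <? proj₁ y
... | yes _   | yes _   = cong (λ t → node t _ _) (leafInsertLeft-insert x l al)
... | no  _   | no  _   = cong (λ t → node _ _ t) (leafInsertLeft-insert x r ar)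
... | yes x≺y | no  a≮b = ⊥-elim (a≮b (≺⇒< x≺y (<-asym j<i)))
... | no  x⊀y | yes a<b = ⊥-elim (x⊀y (inj₁ a<b))

-- Here the new label has the smallest position and goes left at an equal letter, in accordance with
-- the weak test.
leafInsertRight-insert : ∀ x t → AllLabels (λ y → proj₂ y > proj₂ x) t →
  mapₙ proj₁ (insert x t) ≡ leafInsertRight (proj₁ x) (mapₙ proj₁ t)
leafInsertRight-insert x (leaf _) _ = refl
leafInsertRight-insert x (node l y r) (Tree.node al j>i ar) with x ≺? y | proj₁ x ≤? proj₁ y
... | yes _   | yes _   = cong (λ t → node t _ _) (leafInsertRight-insert x l al)
... | no  _   | no  _   = cong (λ t → node _ _ t) (leafInsertRight-insert x r ar)
... | yes x≺y | no  a≰b = ⊥-elim (a≰b (≺⇒≤ x≺y))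
... | no  x⊀y | yes a≤b = ⊥-elim (x⊀y (≤⇒≺ a≤b j>i))

mapₙ-insertAll : ∀ {R : Rel Label 0ℓ} {f : Letter → Tree Letter → Tree Letter} →
  (∀ x t → AllLabels (R x) t → mapₙ proj₁ (insert x t) ≡ f (proj₁ x) (mapₙ proj₁ t)) →
  ∀ {xs} → AllPairs R xs → mapₙ proj₁ (insertAll xs) ≡ foldr f (leaf tt) (map proj₁ xs)
mapₙ-insertAll step [] = refl
mapₙ-insertAll {f = f} step {x ∷ xs} (rx ∷ rxs) =
  trans (step x (insertAll xs) (AllLabels-insertAll rx)) (cong (f (proj₁ x)) (mapₙ-insertAll step rxs))

-- Words

-- Positions count from `1`, like the values of `permutationWord`.
numbered : Word → List Label
numbered u = tabulate λ i → lookup u i , suc (toℕ i)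

numbered-sorted : ∀ u → AllPairs (λ x y → proj₂ x < proj₂ y) (numbered u)
numbered-sorted u = AllPairs.tabulate⁺-< s≤s

map-proj₁-numbered : ∀ u → map proj₁ (numbered u) ≡ u
map-proj₁-numbered u = trans (map-tabulate _ proj₁) (tabulate-lookup u)

map-proj₂-numbered : ∀ u → map proj₂ (numbered u) ≡ map suc (upTo (length u))
map-proj₂-numbered u = begin
  map proj₂ (numbered u)      ≡⟨ map-tabulate _ proj₂ ⟩
  tabulate (suc ∘ toℕ)        ≡⟨ tabulate-toℕ (length u) suc ⟩
  applyUpTo suc (length u)    ≡⟨ map-upTo suc (length u) ⟨
  map suc (upTo (length u))   ∎
  where open ≡-Reasoning

-- Positions increase along `numbered`, so the list is recovered from its rearrangements by sorting
-- on positions.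
numbered-injective : ∀ u v → numbered u ↭ numbered v → u ≡ v
numbered-injective u v p = begin
  u                        ≡⟨ map-proj₁-numbered u ⟨
  map proj₁ (numbered u)   ≡⟨ cong (map proj₁) (sorted-↭⇒≡ <-asym (numbered-sorted u) (numbered-sorted v) p) ⟩
  map proj₁ (numbered v)   ≡⟨ map-proj₁-numbered v ⟩
  v                        ∎
  where open ≡-Reasoning

-- Listed by rank, so that the positions spell the inverse of `std u`.
sortedLabels : Word → List Label
sortedLabels u = tabulate λ k → let i = std u ⟨$⟩ˡ k in lookup u i , suc (toℕ i)

-- `std u` has the inversions of `u`, and two equal letters form no inversion: ranks therefore
-- compare as the pairs do under `_≺_`.
sortedLabels-sorted : ∀ u → AllPairs _≺_ (sortedLabels u)
sortedLabels-sorted u = AllPairs.tabulate⁺-< λ {k} {l} k<l →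
  ordered (subst₂ Fin._<_ (sym (inverseʳ (std u))) (sym (inverseʳ (std u))) k<l)
  where
  ordered : ∀ {i j} → (std u ⟨$⟩ʳ i) Fin.< (std u ⟨$⟩ʳ j) →
    (lookup u i , suc (toℕ i)) ≺ (lookup u j , suc (toℕ j))
  ordered {i} {j} p with <-cmp (toℕ i) (toℕ j)
  ... | tri> _ _ j<i = inj₁ (Equivalence.from (std-sameInversions u j i j<i) p)
  ... | tri≈ _ i≡j _ with refl ← Fin.toℕ-injective i≡j = ⊥-elim (<-irrefl refl p)
  ... | tri< i<j _ _ with <-cmp (lookup u i) (lookup u j)
  ...   | tri< a<b _ _ = inj₁ a<b
  ...   | tri≈ _ a≡b _ = inj₂ (a≡b , s≤s i<j)
  ...   | tri> _ _ b<a = ⊥-elim (<-asym p (Equivalence.to (std-sameInversions u i j i<j) b<a))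

-- Both lists of labels run over all positions, since `std u` is a bijection. All inorder readings
-- of treaps are identified through this lemma.
sorted-numbered : ∀ u {ys} → AllPairs _≺_ ys → ys ↭ numbered u → ys ≡ sortedLabels u
sorted-numbered u sys ys↭u = sorted-unique ≺-asym sys (sortedLabels-sorted u)
  (to ∘ ∈-resp-↭ ys↭u) (∈-resp-↭ (↭-sym ys↭u) ∘ from)
  where
  to : ∀ {z} → z ∈ numbered u → z ∈ sortedLabels u
  to z∈ with i , refl ← ∈-tabulate⁻ z∈ =
    subst (λ j → (lookup u j , suc (toℕ j)) ∈ sortedLabels u) (inverseˡ (std u)) (∈-tabulate⁺ (std u ⟨$⟩ʳ i))

  from : ∀ {z} → z ∈ sortedLabels u → z ∈ numbered u
  from z∈ with k , refl ← ∈-tabulate⁻ z∈ = ∈-tabulate⁺ (std u ⟨$⟩ˡ k)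

map-proj₂-sortedLabels : ∀ u → map proj₂ (sortedLabels u) ≡ permutationWord (flip (std u))
map-proj₂-sortedLabels u = map-tabulate _ proj₂

-- `insertAll` starts from the end of the list, so `reverse` makes the insertion run from left to
-- right.
leftTreap rightTreap : Word → Tree Label
leftTreap  u = insertAll (reverse (numbered u))
rightTreap u = insertAll (numbered u)

leftTreap-treap : ∀ u → Treap _<_ (leftTreap u)
leftTreap-treap u = insertAll-treap <-irrefl (AllPairs-reverse (numbered-sorted u))

rightTreap-treap : ∀ u → Treap _>_ (rightTreap u)
rightTreap-treap u = insertAll-treap (λ x≡y → <-irrefl (sym x≡y)) (numbered-sorted u)

leftTreap-↭ : ∀ u → inorder (leftTreap u) ↭ numbered u
leftTreap-↭ u = ↭-trans (inorder-insertAll _) (↭-reverse (numbered u))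

inorder-leftTreap : ∀ u → inorder (leftTreap u) ≡ sortedLabels u
inorder-leftTreap u = sorted-numbered u (treap-sorted (leftTreap-treap u)) (leftTreap-↭ u)

inorder-rightTreap : ∀ u → inorder (rightTreap u) ≡ sortedLabels u
inorder-rightTreap u = sorted-numbered u (treap-sorted (rightTreap-treap u)) (inorder-insertAll _)

-- The symbols `𝖯` and `𝖰` as projections of the treaps

mapPair : (Label → ℕ) → Word → TreePair ℕ
mapPair f u = mapₙ f (leftTreap u) , mapₙ f (rightTreap u)

𝖯-treaps : ∀ u → 𝖯 u ≡ mapPair proj₁ u
𝖯-treaps u = cong₂ _,_ (sym left) (sym right)
  where
  open ≡-Reasoning
  left : mapₙ proj₁ (leftTreap u) ≡ foldl (λ t a → leafInsertLeft a t) (leaf tt) u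
  left = begin
    mapₙ proj₁ (leftTreap u)
      ≡⟨ mapₙ-insertAll leafInsertLeft-insert (AllPairs-reverse (numbered-sorted u)) ⟩
    foldr leafInsertLeft (leaf tt) (map proj₁ (reverse (numbered u)))
      ≡⟨ cong (foldr leafInsertLeft (leaf tt)) (reverse-map proj₁ (numbered u)) ⟩
    foldr leafInsertLeft (leaf tt) (reverse (map proj₁ (numbered u)))
      ≡⟨ cong (foldr leafInsertLeft (leaf tt) ∘ reverse) (map-proj₁-numbered u) ⟩
    foldr leafInsertLeft (leaf tt) (reverse u)
      ≡⟨ reverse-foldr leafInsertLeft (leaf tt) u ⟩
    foldl (λ t a → leafInsertLeft a t) (leaf tt) u ∎

  right : mapₙ proj₁ (rightTreap u) ≡ foldr leafInsertRight (leaf tt) u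
  right = trans (mapₙ-insertAll leafInsertRight-insert (numbered-sorted u))
                (cong (foldr leafInsertRight (leaf tt)) (map-proj₁-numbered u))

inorder-leftPositions : ∀ u → inorder (mapₙ proj₂ (leftTreap u)) ≡ permutationWord (flip (std u))
inorder-leftPositions u = trans (inorder-mapₙ proj₂ (leftTreap u))
  (trans (cong (map proj₂) (inorder-leftTreap u)) (map-proj₂-sortedLabels u))

inorder-rightPositions : ∀ u → inorder (mapₙ proj₂ (rightTreap u)) ≡ permutationWord (flip (std u))
inorder-rightPositions u = trans (inorder-mapₙ proj₂ (rightTreap u))
  (trans (cong (map proj₂) (inorder-rightTreap u)) (map-proj₂-sortedLabels u))

-- The positions are heap ordered and both trees read the inverse of `std u`; `incr` and `decr`
-- recover such trees from their reading.
𝖰-treaps : ∀ u → 𝖰 u ≡ mapPair proj₂ u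
𝖰-treaps u = cong₂ _,_
  (trans (cong incr (sym (inorder-leftPositions u))) (incr-inorder (treap-parentChild (leftTreap-treap u))))
  (trans (cong decr (sym (inorder-rightPositions u))) (decr-inorder (treap-parentChild (rightTreap-treap u))))

same-inorder : ∀ f u → inorder (proj₁ (mapPair f u)) ≡ inorder (proj₂ (mapPair f u))
same-inorder f u = begin
  inorder (mapₙ f (leftTreap u))    ≡⟨ inorder-mapₙ f (leftTreap u) ⟩
  map f (inorder (leftTreap u))     ≡⟨ cong (map f) (trans (inorder-leftTreap u) (sym (inorder-rightTreap u))) ⟩
  map f (inorder (rightTreap u))    ≡⟨ inorder-mapₙ f (rightTreap u) ⟨
  inorder (mapₙ f (rightTreap u))   ∎
  where open ≡-Reasoning

pairShape-mapPair : ∀ f g u → pairShape (mapPair f u) ≡ pairShape (mapPair g u)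
pairShape-mapPair f g u = cong₂ _,_
  (trans (shape-mapₙ f (leftTreap u)) (sym (shape-mapₙ g (leftTreap u))))
  (trans (shape-mapₙ f (rightTreap u)) (sym (shape-mapₙ g (rightTreap u))))

positions-standard : ∀ u t → inorder t ↭ numbered u → IsStandardLabeled (mapₙ proj₂ t)
positions-standard u t p = standardLabeled (length u) (mapₙ proj₂ t)
  (↭-trans (↭-reflexive (inorder-mapₙ proj₂ t))
    (↭-trans (↭-map⁺ proj₂ p) (↭-reflexive (map-proj₂-numbered u))))

isBaxterPair : ∀ u → IsBaxterPair (𝖯 u , 𝖰 u)
isBaxterPair u rewrite 𝖯-treaps u | 𝖰-treaps u = record
  { twinBST = record
    -- Being twins depends on the shape only, so it is proved for the positions and transported to
    -- the letters.
    { twin         = subst IsTwinShape (pairShape-mapPair proj₂ proj₁ u) twin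
    ; leftBST      = treap-leftBST (leftTreap-treap u)
    ; rightBST     = treap-rightBST (rightTreap-treap u)
    ; same-inorder = same-inorder proj₁ u
    }
  ; twinIncrDecr = record
    { twin         = twin
    ; increasing   = increasing
    ; decreasing   = decreasing
    ; same-inorder = same-inorder proj₂ u
    }
  ; same-shape = pairShape-mapPair proj₁ proj₂ u
  }
  where
  increasing : IsIncreasing (mapₙ proj₂ (leftTreap u))
  increasing = positions-standard u (leftTreap u) (leftTreap-↭ u) , treap-parentChild (leftTreap-treap u)

  decreasing : IsDecreasing (mapₙ proj₂ (rightTreap u))
  decreasing = positions-standard u (rightTreap u) (inorder-insertAll _) , treap-parentChild (rightTreap-treap u)

  twin : IsTwin (mapPair proj₂ u)
  twin = increasing-decreasing⇒twin _ _ increasing decreasing (same-inorder proj₂ u)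

-- Bijectivity of the correspondence

PQ : Word → BaxterPair
PQ u = (𝖯 u , 𝖰 u) , isBaxterPair u

-- The left trees of the two symbols list the letters and the positions in the same order. Together
-- they give the pairs (letter, position), and these give the word.
PQ-injective : Injective _≡_ (_≡_ on proj₁) PQ
PQ-injective {u} {v} eq = numbered-injective u v
  (↭-trans (↭-sym (leftTreap-↭ u)) (↭-trans (↭-reflexive same-labels) (leftTreap-↭ v)))
  where
  project : ∀ f (F : Word → TreePair ℕ) → (∀ w → F w ≡ mapPair f w) → F u ≡ F v →
    map f (inorder (leftTreap u)) ≡ map f (inorder (leftTreap v))
  project f F F≡ Fu≡Fv = begin
    map f (inorder (leftTreap u))     ≡⟨ inorder-mapₙ f (leftTreap u) ⟨
    inorder (proj₁ (mapPair f u))     ≡⟨ cong (inorder ∘ proj₁) (trans (sym (F≡ u)) (trans Fu≡Fv (F≡ v))) ⟩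
    inorder (proj₁ (mapPair f v))     ≡⟨ inorder-mapₙ f (leftTreap v) ⟩
    map f (inorder (leftTreap v))     ∎
    where open ≡-Reasoning

  same-labels : inorder (leftTreap u) ≡ inorder (leftTreap v)
  same-labels = projections-injective
    (project proj₁ 𝖯 𝖯-treaps (cong proj₁ eq)) (project proj₂ 𝖰 𝖰-treaps (cong proj₂ eq))

≡-numbered : ∀ {n ys} → map proj₂ ys ≡ map suc (upTo n) → ys ≡ numbered (map proj₁ ys)
≡-numbered {n} {ys} eq = projections-injective (sym (map-proj₁-numbered (map proj₁ ys))) (begin
  map proj₂ ys                             ≡⟨ eq ⟩
  map suc (upTo n)                         ≡⟨ cong (map suc ∘ upTo) n≡length ⟩
  map suc (upTo (length (map proj₁ ys)))   ≡⟨ map-proj₂-numbered (map proj₁ ys) ⟨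
  map proj₂ (numbered (map proj₁ ys))      ∎)
  where
  open ≡-Reasoning
  n≡length : n ≡ length (map proj₁ ys)
  n≡length = begin
    n                           ≡⟨ length-upTo n ⟨
    length (upTo n)             ≡⟨ length-map suc (upTo n) ⟨
    length (map suc (upTo n))   ≡⟨ cong length eq ⟨
    length (map proj₂ ys)       ≡⟨ length-map proj₂ ys ⟩
    length ys                   ≡⟨ length-map proj₁ ys ⟨
    length (map proj₁ ys)       ∎

preimage : ∀ T S → IsBaxterPair (T , S) → ∃ λ u → (𝖯 u , 𝖰 u) ≡ (T , S)
preimage (Tₗ , Tᵣ) (Sₗ , Sᵣ) valid
  with z , refl , refl ← superpose Tₗ Sₗ (cong proj₁ (IsBaxterPair.same-shape valid))
  -- The positions in `z` are a permutation of `1, …, n`. Lifting it to the pairs gives `ys`, the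
  -- labels of `z` by increasing position, whose letters form the preimage.
  with ys , eq , z↭ys ← ↭-map-inv proj₂ (subst (_↭ map suc (upTo (#nodes (mapₙ proj₂ z))))
    (inorder-mapₙ proj₂ z) (proj₁ (IsTwinIncrDecr.increasing (IsBaxterPair.twinIncrDecr valid)))) =
  u , cong₂ _,_ (cong₂ _,_ 𝖯ₗ 𝖯ᵣ) (cong₂ _,_ 𝖰ₗ 𝖰ᵣ)
  where
  open ≡-Reasoning
  open IsBaxterPair valid
  module T = IsTwinBST twinBST
  module S = IsTwinIncrDecr twinIncrDecr

  u : Word
  u = map proj₁ ys

  z≡ : inorder z ≡ sortedLabels u
  z≡ = sorted-numbered u
    (treap-sorted (leftBST-increasing⇒treap z T.leftBST (proj₂ S.increasing)))
    (↭-trans z↭ys (↭-reflexive (≡-numbered (sym eq))))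

  π≡ : permutationWord (flip (std u)) ≡ inorder (mapₙ proj₂ z)
  π≡ = begin
    permutationWord (flip (std u))   ≡⟨ map-proj₂-sortedLabels u ⟨
    map proj₂ (sortedLabels u)       ≡⟨ cong (map proj₂) z≡ ⟨
    map proj₂ (inorder z)            ≡⟨ inorder-mapₙ proj₂ z ⟨
    inorder (mapₙ proj₂ z)           ∎

  𝖰ₗ : proj₁ (𝖰 u) ≡ mapₙ proj₂ z
  𝖰ₗ = trans (cong incr π≡) (incr-inorder (proj₂ S.increasing))

  -- `Sᵣ` has the same reading as `Sₗ`, and a decreasing tree is determined by its reading.
  𝖰ᵣ : proj₂ (𝖰 u) ≡ Sᵣ
  𝖰ᵣ = trans (cong decr (trans π≡ S.same-inorder)) (decr-inorder (proj₂ S.decreasing))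

  valid-u = isBaxterPair u

  -- The trees of `𝖯 u` are pinned down by shape and inorder reading. The shape is obtained from
  -- `𝖰 u`, already identified with the given pair of position trees.
  shape≡ : pairShape (𝖯 u) ≡ pairShape (mapₙ proj₁ z , Tᵣ)
  shape≡ = begin
    pairShape (𝖯 u)                  ≡⟨ IsBaxterPair.same-shape valid-u ⟩
    pairShape (𝖰 u)                  ≡⟨ cong₂ (λ l r → pairShape (l , r)) 𝖰ₗ 𝖰ᵣ ⟩
    pairShape (mapₙ proj₂ z , Sᵣ)    ≡⟨ same-shape ⟨
    pairShape (mapₙ proj₁ z , Tᵣ)    ∎

  inorderₗ : inorder (proj₁ (𝖯 u)) ≡ inorder (mapₙ proj₁ z)
  inorderₗ = begin
    inorder (proj₁ (𝖯 u))               ≡⟨ cong (inorder ∘ proj₁) (𝖯-treaps u) ⟩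
    inorder (mapₙ proj₁ (leftTreap u))  ≡⟨ inorder-mapₙ proj₁ (leftTreap u) ⟩
    map proj₁ (inorder (leftTreap u))   ≡⟨ cong (map proj₁) (trans (inorder-leftTreap u) (sym z≡)) ⟩
    map proj₁ (inorder z)               ≡⟨ inorder-mapₙ proj₁ z ⟨
    inorder (mapₙ proj₁ z)              ∎

  𝖯ₗ : proj₁ (𝖯 u) ≡ mapₙ proj₁ z
  𝖯ₗ = shape-inorder-injective _ _ (cong proj₁ shape≡) inorderₗ

  𝖯ᵣ : proj₂ (𝖯 u) ≡ Tᵣ
  𝖯ᵣ = shape-inorder-injective _ _ (cong proj₂ shape≡)
    (trans (sym (IsTwinBST.same-inorder (IsBaxterPair.twinBST valid-u))) (trans inorderₗ T.same-inorder))

PQ-surjective : Surjective _≡_ (_≡_ on proj₁) PQ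
PQ-surjective ((T , S) , valid) with u , eq ← preimage T S valid = u , λ { refl → eq }

theorem4p9 : Σ ((u : Word) → IsBaxterPair (𝖯 u , 𝖰 u)) λ valid →
    Bijective {A = Word} {B = BaxterPair} _≡_ (_≡_ on proj₁) (λ u → (𝖯 u , 𝖰 u) , valid u)
theorem4p9 = isBaxterPair , PQ-injective , PQ-surjective
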